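{- Let $\mathcal{G}$ be a graph class. If Clique is NP-hard on $\mathcal{G}$ and $\mathcal{G}$ is closed under adding universal vertices, then Cluster Deletion is NP-hard on $\mathcal{G}$.
   Context: All graphs are finite, undirected and simple. A graph class $\mathcal{G}$ is closed under adding universal vertices if, for every $G\in\mathcal{G}$, the graph obtained from $G$ by adding one new vertex adjacent to every vertex of $G$ also belongs to $\mathcal{G}$. Clique is the problem of finding a maximum clique (set of pairwise adjacent vertices) of a given graph (decision version: given $G$ and an integer $k$, does $G$ have a clique of size at least $k$?). A cluster graph is a graph in which every connected component is a clique. Cluster Deletion is the problem of finding, for a given graph $G$, a minimum-size set $E_-\subseteq E(G)$ such that $G-E_-$ is a cluster graph (decision version: given $G$ and an integer $k$, is there such a set of size at most $k$?). A problem is considered on $\mathcal{G}$ when the input graphs are restricted to members of $\mathcal{G}$. -}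

module Defs where

open import Data.Bool using (Bool; true; false; not; _∧_; T)
open import Data.Bool.Properties using (T?)
open import Data.Fin using (Fin; zero; suc; _<?_)
open import Data.Fin.Subset using (Subset; _∈_; ∣_∣)
open import Data.Integer as ℤ using (ℤ; +_; -[1+_])
open import Data.List as List using (List; []; _∷_; _++_; length; concat; concatMap; replicate)
open import Data.Maybe using (Maybe; just; nothing)
open import Data.Nat as ℕ using (ℕ; suc)
open import Data.Nat.Binary using (ℕᵇ; zero; 2[1+_]; 1+[2_]; fromℕ)
open import Data.Product using (Σ-syntax; ∃; ∃-syntax; _×_; _,_; proj₂)
open import Data.Vec as Vec using (Vec; lookup; updateAt)
open import Function using (_⇔_; _↔_)
open import Level using (Level; _⊔_) renaming (zero to 0ℓ; suc to lsuc)
open import Relation.Binary.Construct.Closure.ReflexiveTransitive using (Star)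
open import Relation.Binary.PropositionalEquality using (_≡_; _≢_; refl; cong; cong₂)
open import Relation.Nullary.Decidable using (_×-dec_)

private variable
  ℓ : Level
  n : ℕ

------------------------------------------------------------------------
-- Graphs

-- A simple graph on the vertex set Fin n, equivalently a set of unordered
-- pairs of distinct elements of Fin n.  Sets of edges to be deleted are
-- represented by the same type.

record SimpleGraph (n : ℕ) : Set where
  field
    adj    : Fin n → Fin n → Bool
    sym    : ∀ u v → adj u v ≡ adj v u
    irrefl : ∀ u → adj u u ≡ false

  Adj : Fin n → Fin n → Set
  Adj u v = T (adj u v)

open SimpleGraph public

Graph : Set
Graph = ∃ SimpleGraph

-- No closure under isomorphism is imposed; isomorphism-closed classes are a
-- special case.

GraphClass : (ℓ : Level) → Set (lsuc ℓ)
GraphClass ℓ = Graph → Set ℓ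

-- The new vertex is zero; the old vertex v becomes suc v.

addUniversal : Graph → Graph
addUniversal (n , G) = suc n , record { adj = adj′ ; sym = sym′ ; irrefl = irrefl′ }
  where
  adj′ : Fin (suc n) → Fin (suc n) → Bool
  adj′ zero    zero    = false
  adj′ zero    (suc _) = true
  adj′ (suc _) zero    = true
  adj′ (suc u) (suc v) = adj G u v

  sym′ : ∀ u v → adj′ u v ≡ adj′ v u
  sym′ zero    zero    = refl
  sym′ zero    (suc _) = refl
  sym′ (suc _) zero    = refl
  sym′ (suc u) (suc v) = sym G u v

  irrefl′ : ∀ u → adj′ u u ≡ false
  irrefl′ zero    = refl
  irrefl′ (suc u) = irrefl G u

ClosedUnderUniversal : GraphClass ℓ → Set ℓ
ClosedUnderUniversal 𝒢 = ∀ G → 𝒢 G → 𝒢 (addUniversal G)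

IsClique : SimpleGraph n → (Fin n → Set) → Set
IsClique G P = ∀ u v → P u → P v → u ≢ v → Adj G u v

Component : SimpleGraph n → Fin n → Fin n → Set
Component G v = Star (Adj G) v

IsClusterGraph : SimpleGraph n → Set
IsClusterGraph G = ∀ v → IsClique G (Component G v)

_⊆ᴱ_ : SimpleGraph n → SimpleGraph n → Set
D ⊆ᴱ G = ∀ u v → Adj D u v → Adj G u v

_∖_ : SimpleGraph n → SimpleGraph n → SimpleGraph n
G ∖ D = record
  { adj    = λ u v → adj G u v ∧ not (adj D u v)
  ; sym    = λ u v → cong₂ (λ a b → a ∧ not b) (sym G u v) (sym D u v)
  ; irrefl = λ u → cong (λ a → a ∧ not (adj D u u)) (irrefl G u)
  }

-- Each unordered pair {u , v} is counted once, with u < v.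

#edges : SimpleGraph n → ℕ
#edges {n} G =
  length (List.filter (λ (u , v) → (u <? v) ×-dec T? (adj G u v))
                      (List.cartesianProduct (List.allFin n) (List.allFin n)))

------------------------------------------------------------------------
-- Machines

-- Multi-stack machines with finite control over a binary alphabet.  A pair
-- of stacks is a two-way infinite tape (the parts left and right of the
-- head), and a stack is a tape used from one end, so these simulate and are
-- simulated by multi-tape Turing machines with linear overhead in time.

data Instr (State : Set) (s : ℕ) : Set where
  halt : Instr State s
  push : Fin s → Bool → State → Instr State s
  -- The next state depends on the removed symbol; it is `nothing` if the
  -- stack was empty, which then stays empty.
  pop  : Fin s → (Maybe Bool → State) → Instr State s

-- Stack 0 is the input and output stack, so there is at least one.

record Machine : Set₁ where
  field
    State  : Set
    finite : ∃[ q ] (State ↔ Fin q)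
    start  : State
    extra  : ℕ
    instr  : State → Instr State (suc extra)

  Stacks : Set
  Stacks = Vec (List Bool) (suc extra)

  Config : Set
  Config = State × Stacks

  exec : Instr State (suc extra) → Stacks → Maybe Config
  exec halt         σ = nothing
  exec (push i b q) σ = just (q , updateAt σ i (b ∷_))
  exec (pop i k)    σ =
    just (k (List.head (lookup σ i)) , updateAt σ i (List.drop 1))

  step : Config → Maybe Config
  step (q , σ) = exec (instr q) σ

  -- HaltsWithin t c σ: from c the machine halts after at most t steps,
  -- with final stack contents σ.
  data HaltsWithin : ℕ → Config → Stacks → Set where
    done : ∀ {t c} → step c ≡ nothing → HaltsWithin t c (proj₂ c)
    more : ∀ {t c c′ σ} → step c ≡ just c′ →
           HaltsWithin t c′ σ → HaltsWithin (suc t) c σ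

  initial : List Bool → Config
  initial w = start , (w Vec.∷ Vec.replicate extra [])

------------------------------------------------------------------------
-- Polynomial time, NP, NP-hardness

data Poly : Set where
  const   : ℕ → Poly
  X       : Poly
  _⊕_ _⊗_ : Poly → Poly → Poly

eval : Poly → ℕ → ℕ
eval (const c) x = c
eval X         x = x
eval (p ⊕ q)   x = eval p x ℕ.+ eval q x
eval (p ⊗ q)   x = eval p x ℕ.* eval q x

PolyTime : (List Bool → List Bool) → Set₁
PolyTime f =
  Σ[ M ∈ Machine ] Σ[ p ∈ Poly ] let open Machine M in
    ∀ w → Σ[ σ ∈ Stacks ]
      (HaltsWithin (eval p (length w)) (initial w) σ × Vec.head σ ≡ f w)

Language : Set₁
Language = List Bool → Set

-- Self-delimiting: every bit of the first word is preceded by `true`, and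
-- `false` marks the beginning of the second word.

pair : List Bool → List Bool → List Bool
pair x y = concatMap (λ b → true ∷ b ∷ []) x ++ (false ∷ y)

-- Polynomial-time verifiers with certificates of polynomial length; the
-- verifier accepts by returning the one-bit word `true`.

NP : Language → Set₁
NP L =
  Σ[ V ∈ (List Bool → List Bool) ] Σ[ p ∈ Poly ] (PolyTime V ×
    (∀ x → L x ⇔ (∃[ y ] (length y ℕ.≤ eval p (length x) × V (pair x y) ≡ true ∷ []))))

-- Decision problem with a specified type of admissible instances.  Words that
-- encode no instance carry no obligation, and the admissible instances need
-- not be recognisable algorithmically.

record Problem (ℓ : Level) : Set (lsuc ℓ) where
  field
    Instance : Set ℓ
    encode   : Instance → List Bool
    Yes      : Instance → Set

-- Polynomial-time many-one reduction; every value of the reduction must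
-- encode an admissible instance.

_≤ₚ_ : Language → Problem ℓ → Set (lsuc 0ℓ ⊔ ℓ)
L ≤ₚ Π =
  Σ[ f ∈ (List Bool → List Bool) ] (PolyTime f ×
    (∀ x → Σ[ i ∈ Instance ] (encode i ≡ f x × (L x ⇔ Yes i))))
  where open Problem Π

NPHard : Problem ℓ → Set (lsuc 0ℓ ⊔ ℓ)
NPHard Π = ∀ L → NP L → L ≤ₚ Π

------------------------------------------------------------------------
-- Clique and Cluster Deletion on a graph class

-- Binary numerals, least significant digit first, in the bijective base-2
-- system of Data.Nat.Binary (digits 1 and 2, written `false` and `true`).

digits : ℕᵇ → List Bool
digits zero     = []
digits 1+[2 x ] = false ∷ digits x
digits 2[1+ x ] = true ∷ digits x

encodeℤ : ℤ → List Bool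
encodeℤ (+ m)    = false ∷ digits (fromℕ m)
encodeℤ -[1+ m ] = true ∷ digits (fromℕ (suc m))

-- The number of vertices in unary, then the adjacency matrix by rows.

encodeGraph : Graph → List Bool
encodeGraph (n , G) =
  replicate n true ++ (false ∷ concat (List.tabulate λ u → List.tabulate (adj G u)))

-- The parameter ranges over all integers.  For Cluster Deletion negative
-- values matter: on a class of cluster graphs they give the only no-instances.

GraphProblemOn : GraphClass ℓ → (Graph → ℤ → Set) → Problem ℓ
GraphProblemOn 𝒢 Q = record
  { Instance = (Σ[ G ∈ Graph ] 𝒢 G) × ℤ
  ; encode   = λ ((G , _) , k) → encodeGraph G ++ encodeℤ k
  ; Yes      = λ ((G , _) , k) → Q G k
  }

HasClique : Graph → ℤ → Set
HasClique (n , G) k = Σ[ S ∈ Subset n ] (IsClique G (_∈ S) × k ℤ.≤ + ∣ S ∣)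

HasClusterDeletion : Graph → ℤ → Set
HasClusterDeletion (n , G) k =
  Σ[ D ∈ SimpleGraph n ] (D ⊆ᴱ G × IsClusterGraph (G ∖ D) × + #edges D ℤ.≤ k)

CliqueOn : GraphClass ℓ → Problem ℓ
CliqueOn 𝒢 = GraphProblemOn 𝒢 HasClique

ClusterDeletionOn : GraphClass ℓ → Problem ℓ
ClusterDeletionOn 𝒢 = GraphProblemOn 𝒢 HasClusterDeletion

{-# OPTIONS --safe #-}

-- Add q + 1 universal vertices to G, where q is at least 1 + n + |E(G)|. A
-- cluster that contains them together with a clique of size s of G leaves at
-- most (q + 1) (n - s) + |E(G)| edges to be deleted. Conversely, in a cluster
-- deletion the old vertices that stay adjacent to a given universal vertex form
-- a clique of G, so if all cliques have fewer than k vertices, then every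
-- universal vertex loses at least n + 1 - k edges. Hence G has a clique of size
-- k if and only if (n + 1 - k) q deletions suffice, where n + 1 - k is replaced by 0
-- if k > n + 1 and by n + 1 if k < 0, and the bound 0 by -1.
--
-- That the construction takes polynomial time is shown in a small structured
-- language over stacks, which is compiled to the given machines.

module Submission where

open import Data.Bool using (Bool; true; false; not; _∧_; T)
open import Data.Bool.Properties using (T?; T-∧; T-≡; ∧-comm)
open import Data.Empty using (⊥-elim)
open import Data.Fin as Fin using (Fin; zero; suc; toℕ; _↑ʳ_)
open import Data.Fin.Properties using (+↔⊎; ↑ʳ-injective)
open import Data.Fin.Subset using (Subset; _∈_; ∣_∣)
open import Data.Integer as ℤ using (ℤ; +_; -[1+_]; +≤+; -≤+)
open import Data.List as List
  using (List; []; _∷_; _++_; _ʳ++_; length; replicate; tabulate; concat)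
open import Data.List.Properties
  using (++-assoc; length-++; length-replicate; map-tabulate; filter-++)
open import Data.Maybe using (Maybe; just; nothing; maybe′)
open import Data.Nat using (ℕ; zero; suc; _+_; _*_; _∸_; _≤_; _<_; _<ᵇ_; _<?_; z≤n; s≤s)
open import Data.Nat.Binary as Bin using (2[1+_]; 1+[2_]; fromℕ; fromℕ')
open import Data.Nat.Binary.Properties using (fromℕ≡fromℕ')
open import Data.Nat.Properties
open import Data.Nat.Tactic.RingSolver using (solve-∀)
open import Data.Product using (∃-syntax; Σ-syntax; _×_; _,_; proj₁; proj₂)
open import Data.Sum using (_⊎_; inj₁; inj₂)
open import Data.Sum.Function.Propositional using (_⊎-↔_)
open import Data.Unit using (tt)
open import Data.Vec as Vec using (Vec; []; _∷_; lookup; updateAt; _[_]≔_)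
open import Data.Vec.Properties
  using ( lookup-++ʳ; lookup∘updateAt; lookup∘updateAt′; updateAt-updateAt; updateAt-commutes
        ; lookup⇒[]=; []=⇒lookup; lookup∘tabulate)
open import Function using (_∘_; id; _↔_; _⇔_; mk⇔; Equivalence)
open import Function.Construct.Composition using (_↔-∘_; _⇔-∘_)
open import Function.Construct.Identity using (↔-id)
open import Function.Construct.Symmetry using (↔-sym)
open import Relation.Binary.Construct.Closure.ReflexiveTransitive using (ε; _◅_)
open import Relation.Binary.PropositionalEquality
  using (_≡_; _≢_; refl; sym; trans; cong; cong₂; subst; subst₂; module ≡-Reasoning)
open import Relation.Nullary using (yes; no; does; _×-dec_)
open import Relation.Unary using (Decidable)

open import Defs hiding (sym)

private variable
  n s : ℕ
  Q   : Set

-- A structured language over stacks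

infixr 5 _⨾_

data Cmd (s : ℕ) : Set where
  skip : Cmd s
  push : Fin s → Bool → Cmd s
  _⨾_  : Cmd s → Cmd s → Cmd s
  -- Pops a bit; the branches are for the empty stack, `false` and `true`.
  case : Fin s → Cmd s → Cmd s → Cmd s → Cmd s
  -- Pops a bit before each round and ends when the stack is empty.
  loop : Fin s → Cmd s → Cmd s

select : Q → Q → Q → Maybe Bool → Q
select x y z nothing      = x
select x y z (just false) = y
select x y z (just true)  = z

-- With one bound B on the rounds of all loops, the time is a polynomial in B that
-- is read off the command.
data Run {s} (B : ℕ) : Cmd s → Vec (List Bool) s → Vec (List Bool) s → Set

data Rounds {s} (B : ℕ) (i : Fin s) (c : Cmd s) :
     ℕ → Vec (List Bool) s → Vec (List Bool) s → Set where
  stop  : ∀ {σ} → lookup σ i ≡ [] → Rounds B i c 0 σ (updateAt σ i (List.drop 1))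
  again : ∀ {m b w σ σ₁ σ₂} → lookup σ i ≡ b ∷ w →
          Run B c (updateAt σ i (List.drop 1)) σ₁ → Rounds B i c m σ₁ σ₂ →
          Rounds B i c (suc m) σ σ₂

data Run B where
  skip : ∀ {σ} → Run B skip σ σ
  push : ∀ {i b σ} → Run B (push i b) σ (updateAt σ i (b ∷_))
  _⨾_  : ∀ {c d σ σ₁ σ₂} → Run B c σ σ₁ → Run B d σ₁ σ₂ → Run B (c ⨾ d) σ σ₂
  case : ∀ {i c d e σ σ′} →
         Run B (select c d e (List.head (lookup σ i))) (updateAt σ i (List.drop 1)) σ′ →
         Run B (case i c d e) σ σ′
  loop : ∀ {i c m σ σ′} → m ≤ B → Rounds B i c m σ σ′ → Run B (loop i c) σ σ′

-- Polynomials have no maximum, so the costs of the three branches are added. `X` stands for the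
-- common bound B on the rounds of every loop.
cost : Cmd s → Poly
cost skip           = const 0
cost (push i b)     = const 1
cost (c ⨾ d)        = cost c ⊕ cost d
cost (case i c d e) = const 1 ⊕ (cost c ⊕ (cost d ⊕ cost e))
cost (loop i c)     = const 1 ⊕ (X ⊗ (const 1 ⊕ cost c))

-- Compilation of commands to instructions

Loc : Cmd s → Set
Loc skip           = Fin 0
Loc (push i b)     = Fin 1
Loc (c ⨾ d)        = Loc c ⊎ Loc d
Loc (case i c d e) = Fin 1 ⊎ (Loc c ⊎ (Loc d ⊎ Loc e))
Loc (loop i c)     = Fin 1 ⊎ Loc c

Finite : Set → Set
Finite A = ∃[ q ] (A ↔ Fin q)

Fin-finite : ∀ n → Finite (Fin n)
Fin-finite n = n , ↔-id (Fin n)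

⊎-finite : ∀ {A B} → Finite A → Finite B → Finite (A ⊎ B)
⊎-finite (m , f) (n , g) = m + n , ↔-sym +↔⊎ ↔-∘ (f ⊎-↔ g)

Loc-finite : (c : Cmd s) → Finite (Loc c)
Loc-finite skip           = Fin-finite 0
Loc-finite (push i b)     = Fin-finite 1
Loc-finite (c ⨾ d)        = ⊎-finite (Loc-finite c) (Loc-finite d)
Loc-finite (case i c d e) =
  ⊎-finite (Fin-finite 1) (⊎-finite (Loc-finite c) (⊎-finite (Loc-finite d) (Loc-finite e)))
Loc-finite (loop i c)     = ⊎-finite (Fin-finite 1) (Loc-finite c)

-- Commands are compiled in continuation style: `ι` places the control locations among the states of
-- a surrounding machine, and `q` is the state after the command. Having no location, `skip` is
-- entered at its exit.
entry : (c : Cmd s) → (Loc c → Q) → Q → Q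
entry skip           ι q = q
entry (push i b)     ι q = ι zero
entry (c ⨾ d)        ι q = entry c (ι ∘ inj₁) (entry d (ι ∘ inj₂) q)
entry (case i c d e) ι q = ι (inj₁ zero)
entry (loop i c)     ι q = ι (inj₁ zero)

code : (c : Cmd s) → (Loc c → Q) → Q → Loc c → Instr Q s
code (push i b)     ι q zero     = push i b q
code (c ⨾ d)        ι q (inj₁ l) = code c (ι ∘ inj₁) (entry d (ι ∘ inj₂) q) l
code (c ⨾ d)        ι q (inj₂ l) = code d (ι ∘ inj₂) q l
code (case i c d e) ι q (inj₁ zero) = pop i
  (select (entry c (ι ∘ inj₂ ∘ inj₁) q)
          (entry d (ι ∘ inj₂ ∘ inj₂ ∘ inj₁) q)
          (entry e (ι ∘ inj₂ ∘ inj₂ ∘ inj₂) q))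
code (case i c d e) ι q (inj₂ (inj₁ l))        = code c (ι ∘ inj₂ ∘ inj₁) q l
code (case i c d e) ι q (inj₂ (inj₂ (inj₁ l))) = code d (ι ∘ inj₂ ∘ inj₂ ∘ inj₁) q l
code (case i c d e) ι q (inj₂ (inj₂ (inj₂ l))) = code e (ι ∘ inj₂ ∘ inj₂ ∘ inj₂) q l
code (loop i c)     ι q (inj₁ zero) =
  pop i (maybe′ (λ _ → entry c (ι ∘ inj₂) (ι (inj₁ zero))) q)
code (loop i c)     ι q (inj₂ l) = code c (ι ∘ inj₂) (ι (inj₁ zero)) l

-- Simulation of commands by machines

module _ (M : Machine) where
  open Machine M

  HaltsWithin-mono : ∀ {t u c σ} → t ≤ u → HaltsWithin t c σ → HaltsWithin u c σ
  HaltsWithin-mono t≤u       (done e)   = done e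
  HaltsWithin-mono (s≤s t≤u) (more e h) = more e (HaltsWithin-mono t≤u h)

  -- A step adds at most one symbol to stack 0. This bounds the input length of a command that runs
  -- after the machine.
  output-length : ∀ {t q} (σ τ : Stacks) → HaltsWithin t (q , σ) τ →
                  length (Vec.head τ) ≤ t + length (Vec.head σ)
  output-length {t} σ _ (done e) = m≤n+m _ t
  output-length {suc t} {q} σ τ (more {c′ = q′ , σ′} e h) =
    ≤-trans (output-length σ′ τ h)
      (≤-trans (+-monoʳ-≤ t (grow σ (instr q) e)) (≤-reflexive (+-suc t _)))
    where
    drop-length : ∀ (w : List Bool) → length (List.drop 1 w) ≤ suc (length w)
    drop-length []      = z≤n
    drop-length (x ∷ w) = m≤n⇒m≤1+n (n≤1+n _)

    grow : ∀ (σ : Stacks) {q′ σ′} (I : Instr State (suc extra)) → exec I σ ≡ just (q′ , σ′) →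
           length (Vec.head σ′) ≤ suc (length (Vec.head σ))
    grow (w ∷ _) (push zero b _)    refl = ≤-refl
    grow (w ∷ _) (push (suc i) b _) refl = n≤1+n _
    grow (w ∷ _) (pop zero k)       refl = drop-length w
    grow (w ∷ _) (pop (suc i) k)    refl = n≤1+n _

  Implements : (c : Cmd (suc extra)) → (Loc c → State) → State → Set
  Implements c ι q = ∀ l → instr (ι l) ≡ code c ι q l

  popped : ∀ {t q i κ m σ τ} → instr q ≡ pop i κ → List.head (lookup σ i) ≡ m →
           HaltsWithin t (κ m , updateAt σ i (List.drop 1)) τ → HaltsWithin (suc t) (q , σ) τ
  popped {σ = σ} e refl = more (cong (λ I → exec I σ) e)

  -- A halting run from the exit state serves as continuation, so a sequence is simulated by
  -- composing two simulations, and the times add up.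
  simulates : ∀ {B c u ι q σ σ′ τ} → Run B c σ σ′ → Implements c ι q →
              HaltsWithin u (q , σ′) τ →
              HaltsWithin (eval (cost c) B + u) (entry c ι q , σ) τ
  simulates-rounds : ∀ {B i c m u ι q σ σ′ τ} → Rounds B i c m σ σ′ →
                     Implements (loop i c) ι q → HaltsWithin u (q , σ′) τ →
                     HaltsWithin (suc (m * suc (eval (cost c) B)) + u) (ι (inj₁ zero) , σ) τ

  simulates skip imp h = h
  simulates {σ = σ} push imp h = more (cong (λ I → exec I σ) (imp zero)) h
  simulates {B} {c ⨾ d} {u} (r ⨾ r′) imp h =
    HaltsWithin-mono (≤-reflexive (sym (+-assoc (eval (cost c) B) _ u)))
      (simulates r (imp ∘ inj₁) (simulates r′ (imp ∘ inj₂) h))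
  simulates {B} {case i c d e} {u} {σ = σ} (case r) imp h with List.head (lookup σ i) in eq
  ... | nothing    = popped (imp (inj₁ zero)) eq
    (HaltsWithin-mono (+-monoˡ-≤ u (m≤m+n _ _)) (simulates r (imp ∘ inj₂ ∘ inj₁) h))
  ... | just false = popped (imp (inj₁ zero)) eq
    (HaltsWithin-mono (+-monoˡ-≤ u (≤-trans (m≤m+n _ _) (m≤n+m _ (eval (cost c) B))))
      (simulates r (imp ∘ inj₂ ∘ inj₂ ∘ inj₁) h))
  ... | just true  = popped (imp (inj₁ zero)) eq
    (HaltsWithin-mono
      (+-monoˡ-≤ u (≤-trans (m≤n+m _ (eval (cost d) B)) (m≤n+m _ (eval (cost c) B))))
      (simulates r (imp ∘ inj₂ ∘ inj₂ ∘ inj₂) h))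
  simulates {u = u} (loop m≤B rs) imp h =
    HaltsWithin-mono (+-monoˡ-≤ u (s≤s (*-monoˡ-≤ _ m≤B))) (simulates-rounds rs imp h)

  simulates-rounds (stop e) imp h = popped (imp (inj₁ zero)) (cong List.head e) h
  simulates-rounds {B} {c = c} {u = u} (again {m = m} e r rs) imp h =
    popped (imp (inj₁ zero)) (cong List.head e)
      (HaltsWithin-mono
        (≤-reflexive (trans (sym (+-assoc k (suc (m * suc k)) u))
                            (cong (_+ u) (+-suc k (m * suc k)))))
        (simulates r (imp ∘ inj₂) (simulates-rounds rs imp h)))
    where k = eval (cost c) B

-- Composition of polynomials

eval-mono : ∀ p {m n} → m ≤ n → eval p m ≤ eval p n
eval-mono (const c) m≤n = ≤-refl
eval-mono X         m≤n = m≤n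
eval-mono (p ⊕ q)   m≤n = +-mono-≤ (eval-mono p m≤n) (eval-mono q m≤n)
eval-mono (p ⊗ q)   m≤n = *-mono-≤ (eval-mono p m≤n) (eval-mono q m≤n)

_[_]ₚ : Poly → Poly → Poly
const c [ r ]ₚ = const c
X       [ r ]ₚ = r
(p ⊕ q) [ r ]ₚ = (p [ r ]ₚ) ⊕ (q [ r ]ₚ)
(p ⊗ q) [ r ]ₚ = (p [ r ]ₚ) ⊗ (q [ r ]ₚ)

eval-subst : ∀ p r n → eval (p [ r ]ₚ) n ≡ eval p (eval r n)
eval-subst (const c) r n = refl
eval-subst X         r n = refl
eval-subst (p ⊕ q)   r n = cong₂ _+_ (eval-subst p r n) (eval-subst q r n)
eval-subst (p ⊗ q)   r n = cong₂ _*_ (eval-subst p r n) (eval-subst q r n)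

-- Running a command after a machine

module _ (k : ℕ) where

  -- The k fresh stacks go right behind stack 0, so a command addresses them by fixed indices
  -- whatever the number of stacks of the first machine. What that machine leaves on its other
  -- stacks lies beyond them.
  embed : ∀ {e} → Vec (List Bool) (suc e) → Vec (List Bool) (suc (k + e))
  embed (w ∷ ρ) = w ∷ (Vec.replicate k [] Vec.++ ρ)

  embedIndex : ∀ {e} → Fin (suc e) → Fin (suc (k + e))
  embedIndex zero    = zero
  embedIndex (suc j) = suc (k ↑ʳ j)

  lookup-embed : ∀ {e} (σ : Vec (List Bool) (suc e)) i →
                 lookup (embed σ) (embedIndex i) ≡ lookup σ i
  lookup-embed (w ∷ ρ) zero    = refl
  lookup-embed (w ∷ ρ) (suc j) = lookup-++ʳ (Vec.replicate k []) ρ j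

  updateAt-embed : ∀ {e} (σ : Vec (List Bool) (suc e)) i f →
                   updateAt (embed σ) (embedIndex i) f ≡ embed (updateAt σ i f)
  updateAt-embed (w ∷ ρ) zero    f = refl
  updateAt-embed {e} (w ∷ ρ) (suc j) f = cong (w ∷_) (go k)
    where
    go : ∀ k → updateAt (Vec.replicate k [] Vec.++ ρ) (k ↑ʳ j) f ≡
               Vec.replicate k [] Vec.++ updateAt ρ j f
    go zero    = refl
    go (suc k) = cong ([] ∷_) (go k)

  module Sequence (M : Machine) (c : Cmd (suc (k + Machine.extra M))) where
    open Machine M

    State′ : Set
    State′ = State ⊎ (Fin 1 ⊎ Loc c)

    end : State′
    end = inj₂ (inj₁ zero)

    fromLoc : Loc c → State′
    fromLoc = inj₂ ∘ inj₂

    instrᶜ : Fin 1 ⊎ Loc c → Instr State′ (suc (k + extra))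
    instrᶜ (inj₁ _) = halt
    instrᶜ (inj₂ l) = code c fromLoc end l

    entryᶜ : Fin 1 ⊎ Loc c
    entryᶜ = entry c inj₂ (inj₁ zero)

    lift : Instr State (suc extra) → Instr State′ (suc (k + extra))
    -- There is no jump instruction, so a halting state takes over the first instruction of the
    -- command.
    lift halt         = instrᶜ entryᶜ
    lift (push i b q) = push (embedIndex i) b (inj₁ q)
    lift (pop i κ)    = pop (embedIndex i) (inj₁ ∘ κ)

    instr′ : State′ → Instr State′ (suc (k + extra))
    instr′ (inj₁ q) = lift (instr q)
    instr′ (inj₂ l) = instrᶜ l

    machine : Machine
    machine = record
      { State  = State′
      ; finite = ⊎-finite finite (⊎-finite (Fin-finite 1) (Loc-finite c))
      ; start  = inj₁ start
      ; extra  = k + extra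
      ; instr  = instr′
      }

    module M′ = Machine machine

    -- `entryᶜ` is computed among the states of the command alone, so that `lift` does not refer to
    -- `instr′`; relabelling identifies it with the entry among all states.
    entry-natural : ∀ {A B : Set} (g : A → B) (d : Cmd (suc (k + extra))) (ι : Loc d → A) q →
                    g (entry d ι q) ≡ entry d (g ∘ ι) (g q)
    entry-natural g skip           ι q = refl
    entry-natural g (push i b)     ι q = refl
    entry-natural g (d ⨾ d′)       ι q =
      trans (entry-natural g d _ _) (cong (entry d _) (entry-natural g d′ _ _))
    entry-natural g (case i _ _ _) ι q = refl
    entry-natural g (loop i d)     ι q = refl

    redirect : ∀ {t q σ τ} → instr q ≡ halt →
               M′.HaltsWithin t (inj₂ entryᶜ , σ) τ → M′.HaltsWithin t (inj₁ q , σ) τ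
    redirect {σ = σ} e (M′.done e′)   =
      M′.done (trans (cong (λ I → M′.exec (lift I) σ) e) e′)
    redirect {σ = σ} e (M′.more e′ h) =
      M′.more (trans (cong (λ I → M′.exec (lift I) σ) e) e′) h

    exec-lift : ∀ I σ {q σ′} → exec I σ ≡ just (q , σ′) →
                M′.exec (lift I) (embed σ) ≡ just (inj₁ q , embed σ′)
    exec-lift (push i b q) σ refl = cong (λ ρ → just (inj₁ q , ρ)) (updateAt-embed σ i _)
    exec-lift (pop i κ)    σ refl = cong₂ (λ w ρ → just (inj₁ (κ (List.head w)) , ρ))
                                      (lookup-embed σ i) (updateAt-embed σ i _)

    halted : ∀ I {σ} → exec I σ ≡ nothing → I ≡ halt
    halted halt refl = refl

    continue : ∀ {t u q σ ρ τ} → HaltsWithin t (q , σ) ρ →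
               M′.HaltsWithin u (inj₂ entryᶜ , embed ρ) τ →
               M′.HaltsWithin (t + u) (inj₁ q , embed σ) τ
    continue {t} {u} {q} (done e) h =
      HaltsWithin-mono machine (m≤n+m u t) (redirect (halted (instr q) e) h)
    continue {q = q} {σ} (more e h′) h =
      M′.more (exec-lift (instr q) σ e) (continue h′ h)

    sequenced : ∀ {t B q σ ρ τ} → HaltsWithin t (q , σ) ρ → Run B c (embed ρ) τ →
                M′.HaltsWithin (t + (eval (cost c) B + 0)) (inj₁ q , embed σ) τ
    sequenced {B = B} {ρ = ρ} {τ} h r = continue h
      (subst (λ l → M′.HaltsWithin (eval (cost c) B + 0) (l , embed ρ) τ)
        (sym (entry-natural inj₂ c inj₂ (inj₁ zero)))
        (simulates machine r (λ _ → refl) (M′.done refl)))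

  -- The output of the first machine is at most as long as its time plus its input. Inserting this
  -- into `b` bounds all loops, and inserting the result into `cost` bounds the time of the command.
  polyTime-then : ∀ {f g} → PolyTime f → (c : ∀ e → Cmd (suc (k + e))) (b : Poly) →
    (∀ x {e} (ρ : Vec (List Bool) e) → ∃[ τ ]
      (Run (eval b (length (f x))) (c e) (embed (f x ∷ ρ)) τ × Vec.head τ ≡ g x)) →
    PolyTime g
  polyTime-then {f} {g} (M , pf , runs) c b c-runs = S.machine , time , λ x → result x (runs x)
    where
    open Machine M
    module S = Sequence M (c extra)

    time : Poly
    time = pf ⊕ ((cost (c extra) [ b [ pf ⊕ X ]ₚ ]ₚ) ⊕ const 0)

    replicate-++ : ∀ k e → Vec.replicate k [] Vec.++ Vec.replicate e [] ≡
                   Vec.replicate (k + e) (List.[] {A = Bool})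
    replicate-++ zero    e = refl
    replicate-++ (suc k) e = cong ([] ∷_) (replicate-++ k e)

    result : ∀ x → Σ[ σ ∈ Stacks ]
             (HaltsWithin (eval pf (length x)) (initial x) σ × Vec.head σ ≡ f x) →
             Σ[ τ ∈ S.M′.Stacks ]
             (S.M′.HaltsWithin (eval time (length x)) (S.M′.initial x) τ × Vec.head τ ≡ g x)
    result x (σ@(w ∷ ρ) , h , refl) with c-runs x ρ
    ... | τ , r , eq =
      τ , subst (λ ρ → S.M′.HaltsWithin (eval time (length x)) (inj₁ start , x ∷ ρ) τ)
            (replicate-++ k extra)
            (HaltsWithin-mono S.machine (+-monoʳ-≤ (eval pf (length x)) (+-monoˡ-≤ 0 bound))
              (S.sequenced h r)) , eq
      where
      bound : eval (cost (c extra)) (eval b (length w)) ≤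
              eval (cost (c extra) [ b [ pf ⊕ X ]ₚ ]ₚ) (length x)
      bound = ≤-trans
        (eval-mono (cost (c extra))
          (≤-trans (eval-mono b (output-length M _ _ h))
                   (≤-reflexive (sym (eval-subst b (pf ⊕ X) (length x))))))
        (≤-reflexive (sym (eval-subst (cost (c extra)) _ (length x))))

-- Loops over unary counters

ones : ℕ → List Bool
ones m = replicate m true

replicate-shift : ∀ {A : Set} m (x : A) w → replicate m x ++ (x ∷ w) ≡ x ∷ replicate m x ++ w
replicate-shift zero    x w = refl
replicate-shift (suc m) x w = cong (x ∷_) (replicate-shift m x w)

-- The symbols of the counter `i` are parked on `j` during the rounds and then moved back, so the
-- same counter can drive later loops.
foreach : Fin s → Fin s → Cmd s → Cmd s
foreach i j c = loop i (push j true ⨾ c) ⨾ loop j (push i true)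

module _ {s} (B : ℕ) (i j : Fin s) (c : Cmd s) where

  -- The contents of the stacks i and j are irrelevant: they hold the loop counter.
  data Iterated : ℕ → Vec (List Bool) s → Vec (List Bool) s → Set where
    []  : ∀ {σ} → Iterated 0 σ σ
    _∷_ : ∀ {m σ σ₁ σ₂} →
          (∀ x y → Run B c (σ [ i ]≔ x [ j ]≔ y) (σ₁ [ i ]≔ x [ j ]≔ y)) →
          Iterated m σ₁ σ₂ → Iterated (suc m) σ σ₂

module _ {s} {B : ℕ} {i j : Fin s} {c : Cmd s} where

  _∷ʳ_ : ∀ {m σ σ₁ σ₂} → Iterated B i j c m σ σ₁ →
         (∀ x y → Run B c (σ₁ [ i ]≔ x [ j ]≔ y) (σ₂ [ i ]≔ x [ j ]≔ y)) →
         Iterated B i j c (suc m) σ σ₂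
  []       ∷ʳ r = r ∷ []
  (r₁ ∷ rs) ∷ʳ r = r₁ ∷ (rs ∷ʳ r)

  -- The invariant form of a counted loop: `σ k` describes the stacks after k rounds, up to the two
  -- counter stacks.
  iterate : ∀ (σ : ℕ → Vec (List Bool) s) m →
            (∀ k → k < m → ∀ x y → Run B c (σ k [ i ]≔ x [ j ]≔ y) (σ (suc k) [ i ]≔ x [ j ]≔ y)) →
            Iterated B i j c m (σ 0) (σ m)
  iterate σ zero    step = []
  iterate σ (suc m) step = iterate σ m (λ k k<m → step k (m≤n⇒m≤1+n k<m)) ∷ʳ step m ≤-refl

  module _ (i≢j : i ≢ j) where

    lookup-i : ∀ (σ : Vec (List Bool) s) x y → lookup (σ [ i ]≔ x [ j ]≔ y) i ≡ x
    lookup-i σ x y = trans (lookup∘updateAt′ i j i≢j (σ [ i ]≔ x)) (lookup∘updateAt i σ)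

    update-i : ∀ (σ : Vec (List Bool) s) x y f →
               updateAt (σ [ i ]≔ x [ j ]≔ y) i f ≡ σ [ i ]≔ f x [ j ]≔ y
    update-i σ x y f = trans (updateAt-commutes i j i≢j (σ [ i ]≔ x))
                             (cong (_[ j ]≔ y) (updateAt-updateAt i σ))

    update-j : ∀ (σ : Vec (List Bool) s) x y f →
               updateAt (σ [ i ]≔ x [ j ]≔ y) j f ≡ σ [ i ]≔ x [ j ]≔ f y
    update-j σ x y f = updateAt-updateAt j (σ [ i ]≔ x)

    consume : ∀ {m σ σ′} → Iterated B i j c m σ σ′ → ∀ k →
              Rounds B i (push j true ⨾ c) m
                (σ [ i ]≔ ones m [ j ]≔ ones k) (σ′ [ i ]≔ [] [ j ]≔ ones (m + k))
    consume {σ = σ} [] k =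
      subst (Rounds B i _ 0 _) (update-i σ [] _ _) (stop (lookup-i σ [] _))
    consume {suc m} {σ} {σ′} (_∷_ {σ₁ = σ₁} r rs) k = again (lookup-i σ _ _)
      (subst (λ τ → Run B (push j true) τ (σ [ i ]≔ ones m [ j ]≔ ones (suc k)))
        (sym (update-i σ _ _ _))
        (subst (Run B (push j true) _) (update-j σ _ _ _) push)
       ⨾ r (ones m) (ones (suc k)))
      (subst (λ l → Rounds B i (push j true ⨾ c) m
                (σ₁ [ i ]≔ ones m [ j ]≔ ones (suc k)) (σ′ [ i ]≔ [] [ j ]≔ ones l))
        (+-suc m k)
        (consume rs (suc k)))

    restore : ∀ (σ : Vec (List Bool) s) m k →
              Rounds B j (push i true) m
                (σ [ i ]≔ ones k [ j ]≔ ones m) (σ [ i ]≔ ones (m + k) [ j ]≔ [])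
    restore σ zero    k =
      subst (Rounds B j _ 0 _) (update-j σ _ _ _) (stop (lookup∘updateAt j (σ [ i ]≔ _)))
    restore σ (suc m) k = again (lookup∘updateAt j (σ [ i ]≔ _))
      (subst (λ τ → Run B (push i true) τ (σ [ i ]≔ ones (suc k) [ j ]≔ ones m))
        (sym (update-j σ _ _ _))
        (subst (Run B (push i true) _) (update-i σ _ _ _) push))
      (subst (λ l → Rounds B j (push i true) m
                (σ [ i ]≔ ones (suc k) [ j ]≔ ones m) (σ [ i ]≔ ones l [ j ]≔ []))
        (+-suc m k)
        (restore σ m (suc k)))

    foreach-run : ∀ {m σ σ′} → m ≤ B → Iterated B i j c m σ σ′ →
                  Run B (foreach i j c) (σ [ i ]≔ ones m [ j ]≔ []) (σ′ [ i ]≔ ones m [ j ]≔ [])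
    foreach-run {m} {σ} {σ′} m≤B rs =
      loop m≤B (consume rs 0) ⨾
      subst₂ (λ k l → Run B (loop j (push i true))
                (σ′ [ i ]≔ [] [ j ]≔ ones k) (σ′ [ i ]≔ ones l [ j ]≔ []))
        (sym (+-identityʳ m)) (+-identityʳ m) (loop m≤B (restore σ′ m 0))

-- The transformation of instances

-- The successor in bijective base 2: the digit 1 (`false`) becomes 2 (`true`), and the digit 2
-- becomes 1 with a carry.
inc : List Bool → List Bool
inc []          = false ∷ []
inc (false ∷ w) = true ∷ w
inc (true ∷ w)  = false ∷ inc w

bits : ℕ → List Bool
bits v = digits (fromℕ v)

bits-suc : ∀ v → bits (suc v) ≡ inc (bits v)
bits-suc v = begin
  digits (fromℕ (suc v))       ≡⟨ cong digits (fromℕ≡fromℕ' (suc v)) ⟩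
  digits (Bin.suc (fromℕ' v))  ≡⟨ digits-suc (fromℕ' v) ⟩
  inc (digits (fromℕ' v))      ≡⟨ cong (inc ∘ digits) (fromℕ≡fromℕ' v) ⟨
  inc (bits v)                 ∎
  where
  open ≡-Reasoning
  digits-suc : ∀ x → digits (Bin.suc x) ≡ inc (digits x)
  digits-suc Bin.zero  = refl
  digits-suc 2[1+ x ]  = cong (false ∷_) (digits-suc x)
  digits-suc 1+[2 x ]  = refl

length-inc : ∀ w → length w ≤ length (inc w)
length-inc []          = z≤n
length-inc (false ∷ w) = ≤-refl
length-inc (true ∷ w)  = s≤s (length-inc w)

length-inc≤ : ∀ w → length (inc w) ≤ suc (length w)
length-inc≤ []          = ≤-refl
length-inc≤ (false ∷ w) = n≤1+n _
length-inc≤ (true ∷ w)  = s≤s (length-inc≤ w)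

length-bits-suc : ∀ v → length (bits v) ≤ length (bits (suc v))
length-bits-suc v rewrite bits-suc v = length-inc (bits v)

length-bits-∸ : ∀ k j → length (bits (k ∸ j)) ≤ length (bits k)
length-bits-∸ k       zero    = ≤-refl
length-bits-∸ zero    (suc j) = ≤-refl
length-bits-∸ (suc k) (suc j) = ≤-trans (length-bits-∸ k j) (length-bits-suc k)

length-bits≤ : ∀ v → length (bits v) ≤ v
length-bits≤ zero    = z≤n
length-bits≤ (suc v) rewrite bits-suc v = ≤-trans (length-inc≤ (bits v)) (s≤s (length-bits≤ v))

-- The bound 0 arises only from k > n, where G has no clique of size k. But 0 deletions suffice for
-- a cluster graph, so an infeasible bound takes its place.
param : ℕ → ℤ
param zero    = -[1+ 0 ]
param (suc v) = + suc v

_⁺ : ℤ → ℕ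
(+ k)    ⁺ = k
-[1+ k ] ⁺ = 0

-- The word that follows is an argument, so that encodings grow at the front, as the program pushes
-- them.
matrix : ∀ {m n} → (Fin m → Fin n → Bool) → List Bool → List Bool
matrix {zero}  f w = w
matrix {suc m} f w = tabulate (f zero) ++ matrix (f ∘ suc) w

reversedMatrix : ∀ {m n} → (Fin m → Fin n → Bool) → List Bool → List Bool
reversedMatrix {zero}  f r = r
reversedMatrix {suc m} f r = reversedMatrix (f ∘ suc) (tabulate (f zero) ʳ++ r)

-- The ones in front of each row are the adjacencies to `a` universal vertices, which precede the
-- other vertices in the numbering.
paddedMatrix : ℕ → ∀ {m n} → (Fin m → Fin n → Bool) → List Bool → List Bool
paddedMatrix a {zero}  f w = w
paddedMatrix a {suc m} f w = ones a ++ (tabulate (f zero) ++ paddedMatrix a (f ∘ suc) w)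

diagonal : ℕ → ℕ → List Bool → List Bool
diagonal W zero    w = w
diagonal W (suc m) w = ones W ++ (false ∷ diagonal W m w)

-- The program for the transformation

module _ {s : ℕ} where

  -- #io is input and output, #a and #b hold 1ⁿ, #q holds 1^q, #r the reversed
  -- adjacency matrix, #t and #u the consumed part of the counters of the outer and
  -- inner loops, #d the truncated n + 1 - k. A loop over #c is a while loop that
  -- goes on as long as its body pushes on #c. #v holds the carried digits, and in
  -- the end the new number of vertices.
  #io #a #b #q #r #t #u #c #v #d : Fin (10 + s)
  #io = zero
  #a  = suc zero
  #b  = suc (suc zero)
  #q  = suc (suc (suc zero))
  #r  = suc (suc (suc (suc zero)))
  #t  = suc (suc (suc (suc (suc zero))))
  #u  = suc (suc (suc (suc (suc (suc zero)))))
  #c  = suc (suc (suc (suc (suc (suc (suc zero))))))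
  #v  = suc (suc (suc (suc (suc (suc (suc (suc zero)))))))
  #d  = suc (suc (suc (suc (suc (suc (suc (suc (suc zero))))))))

  headerBit readHeader moveBit readMatrix dropSign increment decrement : Cmd (10 + s)
  headerBit  = case #io skip skip (push #a true ⨾ push #b true ⨾ push #c true)
  readHeader = push #c true ⨾ loop #c headerBit
  moveBit    = case #io skip (push #r false) (push #r true) ⨾ push #q true
  -- One symbol per row, one per entry and a last one leave q = n (n + 1) + 1 symbols on `#q`.
  readMatrix = foreach #a #t (push #q true ⨾ foreach #b #u moveBit) ⨾ push #q true
  dropSign   = case #io skip skip (loop #io skip)
  increment  = push #c true ⨾
    -- The symbols on `#v` come back as digits 1. On an empty numeral the new leading digit 1 is
    -- produced in this way too.
    loop #c (case #io (push #v true) (push #io true) (push #v true ⨾ push #c true)) ⨾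
    loop #v (push #io false)
  decrement  = push #c true ⨾
    -- If the numeral runs out after borrows, its leading digit 1 vanishes, and one symbol of `#v`
    -- with it. If it was empty from the start, the number is 0 and `#d` counts the decrement.
    loop #c (case #io (case #v (push #d true) skip skip)
                      (push #v true ⨾ push #c true)
                      (push #io false)) ⨾
    loop #v (push #io true)

  addSign writeParam restoreBit writeRows writeUniversal transform : Cmd (10 + s)
  -- The empty numeral is 0 and becomes -1: the sign `true` and the digit 1.
  addSign    = case #io (push #io false ⨾ push #io true)
                        (push #io false ⨾ push #io false)
                        (push #io true ⨾ push #io false)
  -- Of the n + 1 decrements, those made at zero leave the truncated n + 1 - k on `#d`. Then q
  -- increments for each of its symbols build the product in binary.
  writeParam = dropSign ⨾ foreach #a #t decrement ⨾ decrement ⨾ loop #io skip ⨾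
               foreach #d #t (foreach #q #u increment) ⨾ addSign
  restoreBit = case #r skip (push #io false) (push #io true)
  writeRows  = foreach #a #t
    (foreach #b #u restoreBit ⨾ foreach #q #u (push #io true) ⨾ push #io true)
  writeUniversal =
    foreach #a #t (push #io true ⨾ push #v true) ⨾ foreach #q #t (push #v true) ⨾ push #v true ⨾
    foreach #q #t (push #io false ⨾ foreach #v #u (push #io true)) ⨾
    -- The deeper `false` is the diagonal entry of vertex 0, the upper one ends the unary header.
    push #io false ⨾ push #io false ⨾ foreach #v #t (push #io true)
  transform  = readHeader ⨾ readMatrix ⨾ writeParam ⨾ writeRows ⨾ writeUniversal

-- Correctness of the program

module _ {e : ℕ} (ρ : Vec (List Bool) e) (B : ℕ) where

  stk : (io a b q r t u c v d : List Bool) → Vec (List Bool) (10 + e)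
  stk io a b q r t u c v d = io ∷ a ∷ b ∷ q ∷ r ∷ t ∷ u ∷ c ∷ v ∷ d ∷ ρ

  readHeader-rounds : ∀ n {w q r t u v d} k → Rounds B #c headerBit (suc n)
    (stk (ones n ++ (false ∷ w)) (ones k) (ones k) q r t u (true ∷ []) v d)
    (stk w (ones (n + k)) (ones (n + k)) q r t u [] v d)
  readHeader-rounds zero    k = again refl (case skip) (stop refl)
  readHeader-rounds (suc n) {w} {q} {r} {t} {u} {v} {d} k =
    again refl (case (push ⨾ push ⨾ push))
      (subst (λ l → Rounds B #c headerBit (suc n)
                (stk (ones n ++ (false ∷ w)) (ones (suc k)) (ones (suc k)) q r t u (true ∷ []) v d)
                (stk w (ones l) (ones l) q r t u [] v d))
        (+-suc n k) (readHeader-rounds n (suc k)))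

  readHeader-run : ∀ {n w q r t u v d} → n < B →
    Run B readHeader (stk (ones n ++ (false ∷ w)) [] [] q r t u [] v d)
                     (stk w (ones n) (ones n) q r t u [] v d)
  readHeader-run {n} {w} {q} {r} {t} {u} {v} {d} n<B =
    push ⨾ loop n<B (subst (λ l → Rounds B #c headerBit (suc n)
                (stk (ones n ++ (false ∷ w)) [] [] q r t u (true ∷ []) v d)
                (stk w (ones l) (ones l) q r t u [] v d))
              (+-identityʳ n) (readHeader-rounds n 0))

  moveBit-run : ∀ x {w a b q r t u c v d} →
    Run B moveBit (stk (x ∷ w) a b q r t u c v d) (stk w a b (true ∷ q) (x ∷ r) t u c v d)
  moveBit-run false = case push ⨾ push
  moveBit-run true  = case push ⨾ push

  moveRow : ∀ {k} (g : Fin k → Bool) {w a b r t u c v d} l → Iterated B #b #u moveBit k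
    (stk (tabulate g ++ w) a b (ones l) r t u c v d)
    (stk w a b (ones (k + l)) (tabulate g ʳ++ r) t u c v d)
  moveRow {zero}  g l = []
  moveRow {suc k} g {w} {a} {b} {r} {t} {u} {c} {v} {d} l =
    (λ x y → moveBit-run (g zero)) ∷
    subst (λ l′ → Iterated B #b #u moveBit k
             (stk (tabulate (g ∘ suc) ++ w) a b (ones (suc l)) (g zero ∷ r) t u c v d)
             (stk w a b (ones l′) (tabulate (g ∘ suc) ʳ++ (g zero ∷ r)) t u c v d))
      (+-suc k l) (moveRow (g ∘ suc) (suc l))

  moveRows : ∀ {m n} (f : Fin m → Fin n → Bool) {w a r t c v d} l → n ≤ B →
    Iterated B #a #t (push #q true ⨾ foreach #b #u moveBit) m
      (stk (matrix f w) a (ones n) (ones l) r t [] c v d)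
      (stk w a (ones n) (ones (m * suc n + l)) (reversedMatrix f r) t [] c v d)
  moveRows {zero}      f l n≤B = []
  moveRows {suc m} {n} f {w} {a} {r} {t} {c} {v} {d} l n≤B =
    (λ x y → push ⨾ foreach-run (λ ()) n≤B (moveRow (f zero) {b = []} {t = y} {u = []} (suc l))) ∷
    subst (λ l′ → Iterated B #a #t (push #q true ⨾ foreach #b #u moveBit) m
             (stk (matrix (f ∘ suc) w) a (ones n) (ones (n + suc l))
                  (tabulate (f zero) ʳ++ r) t [] c v d)
             (stk w a (ones n) (ones l′) (reversedMatrix f r) t [] c v d))
      (arith m n l) (moveRows (f ∘ suc) (n + suc l) n≤B)
    where
    arith : ∀ m n l → m * suc n + (n + suc l) ≡ suc n + m * suc n + l
    arith = solve-∀

  readMatrix-run : ∀ {n} (f : Fin n → Fin n → Bool) {w c v d} → n ≤ B →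
    Run B readMatrix (stk (matrix f w) (ones n) (ones n) [] [] [] [] c v d)
      (stk w (ones n) (ones n) (ones (suc (n * suc n))) (reversedMatrix f []) [] [] c v d)
  readMatrix-run {n} f {w} {c} {v} {d} n≤B =
    subst (λ l → Run B (foreach #a #t (push #q true ⨾ foreach #b #u moveBit))
             (stk (matrix f w) (ones n) (ones n) [] [] [] [] c v d)
             (stk w (ones n) (ones n) (ones l) (reversedMatrix f []) [] [] c v d))
      (+-identityʳ (n * suc n))
      (foreach-run (λ ()) n≤B (moveRows f {a = ones n} {t = []} 0 n≤B))
    ⨾ push

  clear-rounds : ∀ w {a b q r t u c v d} →
    Rounds B #io skip (length w) (stk w a b q r t u c v d) (stk [] a b q r t u c v d)
  clear-rounds []      = stop refl
  clear-rounds (x ∷ w) = again refl skip (clear-rounds w)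

  dropSign-run : ∀ k {a b q r t u c v d} → length (encodeℤ k) ≤ B →
    Run B dropSign (stk (encodeℤ k) a b q r t u c v d) (stk (bits (k ⁺)) a b q r t u c v d)
  dropSign-run (+ k)    _ = case skip
  dropSign-run -[1+ k ] h = case (loop (<⇒≤ h) (clear-rounds (bits (suc k))))

  fill-rounds : ∀ x l {w a b q r t u c d} → Rounds B #v (push #io x) l
    (stk w a b q r t u c (ones l) d) (stk (replicate l x ++ w) a b q r t u c [] d)
  fill-rounds x zero    = stop refl
  fill-rounds x (suc l) {w} {a} {b} {q} {r} {t} {u} {c} {d} = again refl push
    (subst (λ w′ → Rounds B #v (push #io x) l
               (stk (x ∷ w) a b q r t u c (ones l) d) (stk w′ a b q r t u c [] d))
      (replicate-shift l x w) (fill-rounds x l))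

  -- The symbols on `#v` stand for digits 1 still to be written back. How many rounds and carries
  -- occur depends on `w`, so only bounds and the numeral after writing back are recorded.
  increment-rounds : ∀ w k {a b q r t u d} → ∃[ m ] ∃[ l ] ∃[ x ]
    (Rounds B #c (case #io (push #v true) (push #io true) (push #v true ⨾ push #c true)) m
      (stk w a b q r t u (true ∷ []) (ones k) d) (stk x a b q r t u [] (ones l) d) ×
     m ≤ suc (length w) × l ≤ suc (length w + k) ×
     replicate l false ++ x ≡ replicate k false ++ inc w)
  increment-rounds [] k = 1 , suc k , [] , again refl (case push) (stop refl) , ≤-refl , ≤-refl ,
    sym (replicate-shift k false [])
  increment-rounds (false ∷ w) k = 1 , k , true ∷ w , again refl (case push) (stop refl) ,
    s≤s z≤n , ≤-trans (m≤n+m k (length w)) (m≤n+m _ 2) , refl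
  increment-rounds (true ∷ w) k with increment-rounds w (suc k)
  ... | m , l , x , rs , m≤ , l≤ , eq =
    suc m , l , x , again refl (case (push ⨾ push)) rs , s≤s m≤ ,
    ≤-trans l≤ (≤-reflexive (cong suc (+-suc (length w) k))) ,
    trans eq (sym (replicate-shift k false (inc w)))

  increment-run : ∀ w {a b q r t u d} → length w < B → Run B increment
    (stk w a b q r t u [] [] d) (stk (inc w) a b q r t u [] [] d)
  increment-run w {a} {b} {q} {r} {t} {u} {d} w<B with increment-rounds w 0
  ... | m , l , x , rs , m≤ , l≤ , eq = push ⨾ loop (≤-trans m≤ w<B) rs ⨾
    subst (λ w′ → Run B (loop #v (push #io false)) (stk x a b q r t u [] (ones l) d)
                    (stk w′ a b q r t u [] [] d)) eq
      (loop (≤-trans l≤ (subst (λ j → suc j ≤ B) (sym (+-identityʳ (length w))) w<B))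
            (fill-rounds false l))

  -- A positive numeral is presented as `inc w`, so the result is `w` itself. Here the symbols on
  -- `#v` stand for digits 2, left by borrows.
  decrement-rounds : ∀ w k {a b q r t u d} → ∃[ m ] ∃[ l ] ∃[ x ]
    (Rounds B #c (case #io (case #v (push #d true) skip skip)
                           (push #v true ⨾ push #c true)
                           (push #io false)) m
      (stk (inc w) a b q r t u (true ∷ []) (ones k) d) (stk x a b q r t u [] (ones l) d) ×
     m ≤ suc (length (inc w)) × l ≤ length w + k ×
     replicate l true ++ x ≡ replicate k true ++ w)
  decrement-rounds [] k = 2 , k , [] ,
    again refl (case (push ⨾ push)) (again refl (case (case skip)) (stop refl)) ,
    ≤-refl , ≤-refl , refl
  decrement-rounds (false ∷ w) k = 1 , k , false ∷ w , again refl (case push) (stop refl) ,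
    s≤s z≤n , m≤n+m k (suc (length w)) , refl
  decrement-rounds (true ∷ w) k with decrement-rounds w (suc k)
  ... | m , l , x , rs , m≤ , l≤ , eq =
    suc m , l , x , again refl (case (push ⨾ push)) rs , s≤s m≤ ,
    ≤-trans l≤ (≤-reflexive (+-suc (length w) k)) ,
    trans eq (sym (replicate-shift k true w))

  decrement-run : ∀ w {a b q r t u d} → length (inc w) < B → Run B decrement
    (stk (inc w) a b q r t u [] [] d) (stk w a b q r t u [] [] d)
  decrement-run w {a} {b} {q} {r} {t} {u} {d} w<B with decrement-rounds w 0
  ... | m , l , x , rs , m≤ , l≤ , eq = push ⨾ loop (≤-trans m≤ w<B) rs ⨾
    subst (λ w′ → Run B (loop #v (push #io true)) (stk x a b q r t u [] (ones l) d)
                    (stk w′ a b q r t u [] [] d)) eq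
      (loop (≤-trans l≤ (≤-trans (≤-reflexive (+-identityʳ _)) (≤-trans (length-inc w) (<⇒≤ w<B))))
            (fill-rounds true l))

  decrement-zero : ∀ {a b q r t u d} → 0 < B → Run B decrement
    (stk [] a b q r t u [] [] d) (stk [] a b q r t u [] [] (true ∷ d))
  decrement-zero 0<B =
    push ⨾ loop 0<B (again refl (case (case push)) (stop refl)) ⨾ loop z≤n (stop refl)

  -- The invariant of repeated decrements: after j of them the numeral holds k ∸ j, and `#d` has one
  -- symbol for each decrement made at zero, j ∸ k in all.
  countdown : ∀ k j {a b q r t u} → length (bits k) < B → Run B decrement
    (stk (bits (k ∸ j)) a b q r t u [] [] (ones (j ∸ k)))
    (stk (bits (k ∸ suc j)) a b q r t u [] [] (ones (suc j ∸ k)))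
  countdown zero zero    k<B = decrement-zero (≤-trans (s≤s z≤n) k<B)
  countdown zero (suc j) k<B = decrement-zero (≤-trans (s≤s z≤n) k<B)
  countdown (suc k) (suc j) k<B = countdown k j (≤-<-trans (length-bits-suc k) k<B)
  countdown (suc k) zero {a} {b} {q} {r} {t} {u} k<B
    rewrite bits-suc k | 0∸n≡0 k = decrement-run (bits k) k<B

  addSign-run : ∀ v {a b q r t u c v′ d} → Run B addSign
    (stk (bits v) a b q r t u c v′ d) (stk (encodeℤ (param v)) a b q r t u c v′ d)
  addSign-run zero    = case (push ⨾ push)
  addSign-run (suc v) rewrite bits-suc v with bits v
  ... | []        = case (push ⨾ push)
  ... | false ∷ w = case (push ⨾ push)
  ... | true ∷ w  = case (push ⨾ push)

  writeParam-run : ∀ k n q {b r} → let c = suc n ∸ k ⁺ in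
    length (encodeℤ k) ≤ B → length (bits (k ⁺)) < B → suc n * q < B → suc n ≤ B → q ≤ B →
    Run B writeParam
      (stk (encodeℤ k) (ones n) b (ones q) r [] [] [] [] [])
      (stk (encodeℤ (param (c * q))) (ones n) b (ones q) r [] [] [] [] (ones c))
  writeParam-run k n q {b} {r} hk hk⁺ hcq hn hq =
    dropSign-run k hk ⨾
    subst (λ l → Run B (foreach #a #t decrement)
             (stk (bits (k ⁺)) (ones n) b (ones q) r [] [] [] [] (ones l))
             (stk (bits (k ⁺ ∸ n)) (ones n) b (ones q) r [] [] [] [] (ones (n ∸ k ⁺))))
      (0∸n≡0 (k ⁺))
      (foreach-run (λ ()) (<⇒≤ hn)
        (iterate (λ j → stk (bits (k ⁺ ∸ j)) (ones n) b (ones q) r [] [] [] [] (ones (j ∸ k ⁺))) n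
          (λ j _ x y → countdown (k ⁺) j hk⁺))) ⨾
    countdown (k ⁺) n hk⁺ ⨾
    loop (≤-trans (length-bits-∸ (k ⁺) (suc n)) (<⇒≤ hk⁺)) (clear-rounds (bits (k ⁺ ∸ suc n))) ⨾
    foreach-run (λ ()) (≤-trans (m∸n≤m (suc n) (k ⁺)) hn)
      (iterate (λ j → stk (bits (j * q)) (ones n) b (ones q) r [] [] [] [] (ones c)) c
        (λ j j<c x y → foreach-run (λ ()) hq
          (iterate (λ i → stk (bits (i + j * q)) (ones n) b (ones q) r y [] [] [] x) q
            (λ i i<q x′ y′ → subst (λ w → Run B increment
                  (stk (bits (i + j * q)) (ones n) b x′ r y y′ [] [] x)
                  (stk w (ones n) b x′ r y y′ [] [] x))
                (sym (bits-suc (i + j * q)))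
                (increment-run (bits (i + j * q)) (bound i i<q j j<c)))))) ⨾
    addSign-run (c * q)
    where
    c = suc n ∸ k ⁺
    -- A numeral is no longer than its value, and the value stays below (n + 1) q.
    bound : ∀ i → i < q → ∀ j → j < c → length (bits (i + j * q)) < B
    bound i i<q j j<c = ≤-<-trans (length-bits≤ (i + j * q))
      (<-trans (+-monoˡ-< (j * q) i<q)
        (≤-<-trans (*-monoˡ-≤ q (≤-trans j<c (m∸n≤m (suc n) (k ⁺)))) hcq))

  restoreBit-run : ∀ x {io a b q r t u c v d} →
    Run B restoreBit (stk io a b q (x ∷ r) t u c v d) (stk (x ∷ io) a b q r t u c v d)
  restoreBit-run false = case push
  restoreBit-run true  = case push

  -- `#r` returns the entries from last to first, so the first entry of a row is restored in the
  -- last round.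
  restoreRow : ∀ {k} (g : Fin k → Bool) {w a b q r t u c v d} → Iterated B #b #u restoreBit k
    (stk w a b q (tabulate g ʳ++ r) t u c v d) (stk (tabulate g ++ w) a b q r t u c v d)
  restoreRow {zero}  g = []
  restoreRow {suc k} g = restoreRow (g ∘ suc) ∷ʳ λ x y → restoreBit-run (g zero)

  restoreRows : ∀ {m n} (f : Fin m → Fin n → Bool) {w a p r t c v d} → n ≤ B → p ≤ B →
    Iterated B #a #t (foreach #b #u restoreBit ⨾ foreach #q #u (push #io true) ⨾ push #io true) m
      (stk w a (ones n) (ones p) (reversedMatrix f r) t [] c v d)
      (stk (paddedMatrix (suc p) f w) a (ones n) (ones p) r t [] c v d)
  restoreRows {zero}  f n≤B p≤B = []
  restoreRows {suc m} {n} f {w} {a} {p} {r} {t} {c} {v} {d} n≤B p≤B =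
    restoreRows (f ∘ suc) n≤B p≤B ∷ʳ λ x y →
      foreach-run (λ ()) n≤B (restoreRow (f zero) {b = []} {t = y} {u = []}) ⨾
      foreach-run (λ ()) p≤B
        (iterate (λ j → stk (ones j ++ (tabulate (f zero) ++ paddedMatrix (suc p) (f ∘ suc) w))
                            x (ones n) (ones p) r y [] c v d) p (λ _ _ _ _ → push)) ⨾
      push

  writeUniversal-run : ∀ n q {w b r d} → let W = suc (q + n) in W ≤ B →
    Run B writeUniversal
      (stk w (ones n) b (ones q) r [] [] [] [] d)
      (stk (ones W ++ (false ∷ false ∷ diagonal W q (ones n ++ w)))
           (ones n) b (ones q) r [] [] [] (ones W) d)
  writeUniversal-run n q {w} {b} {r} {d} W≤B =
    foreach-run (λ ()) (≤-trans (m≤n+m n (suc q)) W≤B)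
      (iterate (λ j → stk (ones j ++ w) (ones n) b (ones q) r [] [] [] (ones j) d) n
        (λ _ _ _ _ → push ⨾ push)) ⨾
    foreach-run (λ ()) q≤B
      (iterate (λ j → stk (ones n ++ w) (ones n) b (ones q) r [] [] [] (ones (j + n)) d) q
        (λ _ _ _ _ → push)) ⨾
    push ⨾
    foreach-run (λ ()) q≤B
      (iterate (λ j → stk (diagonal W j (ones n ++ w)) (ones n) b (ones q) r [] [] [] (ones W) d) q
        (λ j _ x y → push ⨾ foreach-run (λ ()) W≤B
          (iterate (λ i → stk (ones i ++ (false ∷ diagonal W j (ones n ++ w)))
                              (ones n) b x r y [] [] (ones W) d) W
            (λ _ _ _ _ → push)))) ⨾
    push ⨾ push ⨾
    foreach-run (λ ()) W≤B
      (iterate (λ i → stk (ones i ++ (false ∷ false ∷ diagonal W q (ones n ++ w)))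
                          (ones n) b (ones q) r [] [] [] (ones W) d) W
        (λ _ _ _ _ → push))
    where
    W = suc (q + n)
    q≤B : q ≤ B
    q≤B = ≤-trans (≤-trans (m≤m+n q n) (n≤1+n _)) W≤B

-- The encoding of the enlarged graph

addUniversals : ∀ m {n} → SimpleGraph n → SimpleGraph (m + n)
addUniversals zero    G = G
addUniversals (suc m) G = proj₂ (addUniversal (_ , addUniversals m G))

-- The q of the header; n * n is a crude bound on |E(G)|.
scale : ℕ → ℕ
scale n = suc (n * suc n)

targetParam : ℕ → ℤ → ℤ
targetParam n k = param ((suc n ∸ k ⁺) * scale n)

concat≡matrix : ∀ {m n} (f : Fin m → Fin n → Bool) w →
                concat (tabulate λ u → tabulate (f u)) ++ w ≡ matrix f w
concat≡matrix {zero}  f w = refl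
concat≡matrix {suc m} f w = trans (++-assoc (tabulate (f zero)) _ w)
                                  (cong (tabulate (f zero) ++_) (concat≡matrix (f ∘ suc) w))

encodeGraph-++ : ∀ {n} (G : SimpleGraph n) w →
                 encodeGraph (n , G) ++ w ≡ ones n ++ (false ∷ matrix (adj G) w)
encodeGraph-++ {n} G w = trans (++-assoc (ones n) _ w)
                               (cong (λ v → ones n ++ (false ∷ v)) (concat≡matrix (adj G) w))

replicate-+ : ∀ m n {w} → ones m ++ (ones n ++ w) ≡ ones (m + n) ++ w
replicate-+ zero    n = refl
replicate-+ (suc m) n = cong (true ∷_) (replicate-+ m n)

tabulate-true : ∀ n → tabulate {n = n} (λ _ → true) ≡ ones n
tabulate-true zero    = refl
tabulate-true (suc n) = cong (true ∷_) (tabulate-true n)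

paddedMatrix-0 : ∀ {m n} (f : Fin m → Fin n → Bool) w → paddedMatrix 0 f w ≡ matrix f w
paddedMatrix-0 {zero}  f w = refl
paddedMatrix-0 {suc m} f w = cong (tabulate (f zero) ++_) (paddedMatrix-0 (f ∘ suc) w)

-- The column of ones that a universal vertex adds to the rows below its own is absorbed in their
-- padding.
paddedMatrix-suc : ∀ a {m n} (f : Fin m → Fin (suc n) → Bool) → (∀ u → f u zero ≡ true) → ∀ w →
                   paddedMatrix a f w ≡ paddedMatrix (suc a) (λ u v → f u (suc v)) w
paddedMatrix-suc a {zero}  f f0 w = refl
paddedMatrix-suc a {suc m} f f0 w rewrite f0 zero =
  trans (replicate-shift a true _)
    (cong (λ v → true ∷ ones a ++ (tabulate (λ v → f zero (suc v)) ++ v))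
      (paddedMatrix-suc a (f ∘ suc) (f0 ∘ suc) w))

padded-universal : ∀ a m {n} (G : SimpleGraph n) w →
  paddedMatrix a (adj (addUniversals (suc m) G)) w ≡
  ones a ++ (false ∷ ones (m + n) ++ paddedMatrix (suc a) (adj (addUniversals m G)) w)
padded-universal a m {n} G w = cong₂ (λ x y → ones a ++ (false ∷ x ++ y))
  (tabulate-true (m + n)) (paddedMatrix-suc a (adj (addUniversals (suc m) G) ∘ suc) (λ _ → refl) w)

-- Between two consecutive diagonal entries of a matrix of width W there are W
-- entries, which is why the rows of the universal vertices form a periodic word.
padded-diagonal : ∀ a m {n} (G : SimpleGraph n) w →
  paddedMatrix a (adj (addUniversals (suc m) G)) w ≡
  ones a ++ (false ∷ diagonal (suc (a + m) + n) m
                       (ones n ++ paddedMatrix (suc (a + m)) (adj G) w))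
padded-diagonal a zero {n} G w rewrite +-identityʳ a = padded-universal a 0 G w
padded-diagonal a (suc m) {n} G w = begin
  paddedMatrix a (adj (addUniversals (suc (suc m)) G)) w
    ≡⟨ padded-universal a (suc m) G w ⟩
  ones a ++ (false ∷ ones (suc m + n) ++ paddedMatrix (suc a) (adj (addUniversals (suc m) G)) w)
    ≡⟨ cong (λ v → ones a ++ (false ∷ ones (suc m + n) ++ v)) (padded-diagonal (suc a) m G w) ⟩
  ones a ++ (false ∷ ones (suc m + n) ++ (ones (suc a) ++ (false ∷ rest (suc a + m))))
    -- The ones after this diagonal entry and those before the next one merge into one block.
    ≡⟨ cong (λ v → ones a ++ (false ∷ v)) (replicate-+ (suc m + n) (suc a)) ⟩
  ones a ++ (false ∷ ones (suc m + n + suc a) ++ (false ∷ rest (suc a + m)))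
    ≡⟨ cong (λ l → ones a ++ (false ∷ ones l ++ (false ∷ rest (suc a + m)))) (arith a m n) ⟩
  ones a ++ (false ∷ ones (suc (suc a + m) + n) ++ (false ∷ rest (suc a + m)))
    ≡⟨ cong (λ l → ones a ++ (false ∷ ones (suc l + n) ++ (false ∷ rest l))) (+-suc a m) ⟨
  ones a ++ (false ∷ ones (suc (a + suc m) + n) ++ (false ∷ rest (a + suc m))) ∎
  where
  open ≡-Reasoning
  rest : ℕ → List Bool
  rest l = diagonal (suc l + n) m (ones n ++ paddedMatrix (suc l) (adj G) w)
  arith : ∀ a m n → suc m + n + suc a ≡ suc (suc a + m) + n
  arith = solve-∀

encode-addUniversals : ∀ m {n} (G : SimpleGraph n) w →
  encodeGraph (suc m + n , addUniversals (suc m) G) ++ w ≡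
  ones (suc m + n) ++ (false ∷ false ∷ diagonal (suc m + n) m
                         (ones n ++ paddedMatrix (suc m) (adj G) w))
encode-addUniversals m {n} G w =
  trans (encodeGraph-++ (addUniversals (suc m) G) w)
    (cong (λ v → ones (suc m + n) ++ (false ∷ v))
      (trans (sym (paddedMatrix-0 (adj (addUniversals (suc m) G)) w)) (padded-diagonal 0 m G w)))

-- The time bound of the transformation

transform-run : ∀ {e} (ρ : Vec (List Bool) e) B {n} (G : SimpleGraph n) k → let q = scale n in
  n < B → length (encodeℤ k) ≤ B → length (bits (k ⁺)) < B → suc n * q < B → suc (q + n) ≤ B →
  ∃[ τ ] (Run B transform
            (stk ρ B (encodeGraph (n , G) ++ encodeℤ k) [] [] [] [] [] [] [] [] []) τ ×
          Vec.head τ ≡ encodeGraph (suc q + n , addUniversals (suc q) G) ++ encodeℤ (targetParam n k))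
transform-run ρ B {n} G k n<B hk hk⁺ hcq hW
  rewrite encodeGraph-++ G (encodeℤ k)
        | encode-addUniversals (scale n) G (encodeℤ (targetParam n k)) =
  _ , (readHeader-run ρ B n<B ⨾
       readMatrix-run ρ B (adj G) (<⇒≤ n<B) ⨾
       writeParam-run ρ B k n (scale n) hk hk⁺ hcq n<B q≤B ⨾
       foreach-run (λ ()) (<⇒≤ n<B)
         (restoreRows ρ B (adj G) {a = []} {t = []} (<⇒≤ n<B) q≤B) ⨾
       writeUniversal-run ρ B n (scale n) hW) , refl
  where
  q≤B : scale n ≤ B
  q≤B = ≤-trans (≤-trans (m≤m+n (scale n) n) (n≤1+n _)) hW

length-bits-⁺ : ∀ k → length (bits (k ⁺)) ≤ length (encodeℤ k)
length-bits-⁺ (+ _)    = n≤1+n _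
length-bits-⁺ -[1+ _ ] = z≤n

-- At L this is 2 + L + (L + 1) `scale` L. Since n and the length of the encoded parameter are at
-- most L, it dominates all loop counters.
boundₚ : Poly
boundₚ = const 2 ⊕ (X ⊕ ((const 1 ⊕ X) ⊗ (const 1 ⊕ (X ⊗ (const 1 ⊕ X)))))

transform-bounded : ∀ {e} (ρ : Vec (List Bool) e) {n} (G : SimpleGraph n) k →
  let w = encodeGraph (n , G) ++ encodeℤ k in ∃[ τ ]
  (Run (eval boundₚ (length w)) transform (embed 9 (w ∷ ρ)) τ ×
   Vec.head τ ≡ encodeGraph (suc (scale n) + n , addUniversals (suc (scale n)) G) ++
                encodeℤ (targetParam n k))
transform-bounded ρ {n} G k = transform-run ρ B G k
    (s≤s (≤-trans n≤L (≤-trans L≤ (n≤1+n _))))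
    (≤-trans k≤L (≤-trans L≤ (m≤n+m _ 2)))
    (s≤s (≤-trans (length-bits-⁺ k) (≤-trans k≤L (≤-trans L≤ (n≤1+n _)))))
    (s≤s (≤-trans nq≤ (≤-trans (m≤n+m _ L) (n≤1+n _))))
    (s≤s (≤-trans (≤-reflexive (+-comm (scale n) n))
      (≤-trans (+-mono-≤ n≤L (≤-trans (m≤m+n (scale n) (n * scale n)) nq≤)) (n≤1+n _))))
  where
  w = encodeGraph (n , G) ++ encodeℤ k
  L = length w
  B = eval boundₚ L
  length-w : L ≡ length (encodeGraph (n , G)) + length (encodeℤ k)
  length-w = length-++ (encodeGraph (n , G))
  -- The number of vertices is written in unary, so it is bounded by the length of the word.
  n≤L : n ≤ L
  n≤L = begin
    n                                    ≡⟨ length-replicate n ⟨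
    length (ones n)                      ≤⟨ m≤m+n _ _ ⟩
    length (ones n) + _                  ≡⟨ length-++ (ones n) ⟨
    length (encodeGraph (n , G))         ≤⟨ m≤m+n _ _ ⟩
    length (encodeGraph (n , G)) + length (encodeℤ k) ≡⟨ length-w ⟨
    L                                    ∎
    where open ≤-Reasoning
  k≤L : length (encodeℤ k) ≤ L
  k≤L = ≤-trans (m≤n+m _ (length (encodeGraph (n , G)))) (≤-reflexive (sym length-w))
  L≤ : L ≤ L + suc L * scale L
  L≤ = m≤m+n L _
  nq≤ : suc n * scale n ≤ suc L * scale L
  nq≤ = *-mono-≤ (s≤s n≤L) (s≤s (*-mono-≤ n≤L (s≤s n≤L)))

-- Cliques and cluster deletions

toBit : Bool → ℕ
toBit false = 0
toBit true  = 1

count : (Fin n → Bool) → ℕ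
count {zero}  p = 0
count {suc n} p = toBit (p zero) + count (p ∘ suc)

-- The recursion removes vertex 0, the one that `addUniversals` adds last, so this form of the edge
-- count unfolds along that construction.
edgeCount : (Fin n → Fin n → Bool) → ℕ
edgeCount {zero}  a = 0
edgeCount {suc n} a = count (λ v → a zero (suc v)) + edgeCount (λ u v → a (suc u) (suc v))

length-filter-tabulate : ∀ {A : Set} {P : A → Set} (P? : Decidable P) (f : Fin n → A) →
  length (List.filter P? (tabulate f)) ≡ count (does ∘ P? ∘ f)
length-filter-tabulate {zero}  P? f = refl
length-filter-tabulate {suc n} P? f with does (P? (f zero))
... | true  = cong suc (length-filter-tabulate P? (f ∘ suc))
... | false = length-filter-tabulate P? (f ∘ suc)

rowSum : ∀ {m} → (Fin m → Fin n → Bool) → ℕ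
rowSum {m = zero}  a = 0
rowSum {m = suc m} a = count (a zero) + rowSum (a ∘ suc)

length-filter-product : ∀ {m} {A B : Set} {P : A × B → Set} (P? : Decidable P)
  (f : Fin m → A) (g : Fin n → B) →
  length (List.filter P? (List.cartesianProduct (tabulate f) (tabulate g))) ≡
  rowSum (λ u v → does (P? (f u , g v)))
length-filter-product {m = zero}  P? f g = refl
length-filter-product {m = suc m} P? f g = begin
  length (List.filter P? (List.map (f zero ,_) (tabulate g) ++ rest))
    ≡⟨ cong length (filter-++ P? (List.map (f zero ,_) (tabulate g)) rest) ⟩
  length (List.filter P? (List.map (f zero ,_) (tabulate g)) ++ List.filter P? rest)
    ≡⟨ length-++ (List.filter P? (List.map (f zero ,_) (tabulate g))) ⟩
  length (List.filter P? (List.map (f zero ,_) (tabulate g))) + length (List.filter P? rest)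
    ≡⟨ cong₂ _+_ (trans (cong (length ∘ List.filter P?) (map-tabulate g (f zero ,_)))
                        (length-filter-tabulate P? ((f zero ,_) ∘ g)))
                 (length-filter-product P? (f ∘ suc) g) ⟩
  count (λ v → does (P? (f zero , g v))) + rowSum (λ u v → does (P? (f (suc u) , g v))) ∎
  where
  open ≡-Reasoning
  rest = List.cartesianProduct (tabulate (f ∘ suc)) (tabulate g)

rowSum-shift : ∀ {m} (a : Fin m → Fin (suc n) → Bool) → (∀ u → a u zero ≡ false) →
               rowSum a ≡ rowSum (λ u v → a u (suc v))
rowSum-shift {m = zero}  a a0 = refl
rowSum-shift {m = suc m} a a0 rewrite a0 zero =
  cong (_+_ (count (λ v → a zero (suc v)))) (rowSum-shift (a ∘ suc) (a0 ∘ suc))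

rowSum-upper : (a : Fin n → Fin n → Bool) →
               rowSum (λ u v → (toℕ u <ᵇ toℕ v) ∧ a u v) ≡ edgeCount a
rowSum-upper {zero}  a = refl
rowSum-upper {suc n} a = cong (_+_ (count (λ v → a zero (suc v))))
  (trans (rowSum-shift (λ u v → (toℕ (suc u) <ᵇ toℕ v) ∧ a (suc u) v) (λ u → refl))
         (rowSum-upper (λ u v → a (suc u) (suc v))))

#edges≡edgeCount : (G : SimpleGraph n) → #edges G ≡ edgeCount (adj G)
#edges≡edgeCount G = trans
  (length-filter-product (λ (u , v) → (u Fin.<? v) ×-dec T? (adj G u v)) id id)
  (rowSum-upper (adj G))

count≤ : (p : Fin n → Bool) → count p ≤ n
count≤ {zero}  p = z≤n
count≤ {suc n} p with p zero
... | true  = s≤s (count≤ (p ∘ suc))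
... | false = m≤n⇒m≤1+n (count≤ (p ∘ suc))

count-not : (p : Fin n → Bool) → count p + count (not ∘ p) ≡ n
count-not {zero}  p = refl
count-not {suc n} p with p zero
... | true  = cong suc (count-not (p ∘ suc))
... | false = trans (+-suc _ _) (cong suc (count-not (p ∘ suc)))

count-↑ʳ : ∀ m (p : Fin (m + n) → Bool) → count (p ∘ (m ↑ʳ_)) ≤ count p
count-↑ʳ zero    p = ≤-refl
count-↑ʳ (suc m) p = ≤-trans (count-↑ʳ m (p ∘ suc)) (m≤n+m _ (toBit (p zero)))

∣S∣≡count : (S : Subset n) → ∣ S ∣ ≡ count (lookup S)
∣S∣≡count []          = refl
∣S∣≡count (true ∷ S)  = cong suc (∣S∣≡count S)
∣S∣≡count (false ∷ S) = ∣S∣≡count S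

∣tabulate∣≡count : (p : Fin n → Bool) → ∣ Vec.tabulate p ∣ ≡ count p
∣tabulate∣≡count {zero}  p = refl
∣tabulate∣≡count {suc n} p with p zero
... | true  = cong suc (∣tabulate∣≡count (p ∘ suc))
... | false = ∣tabulate∣≡count (p ∘ suc)

edgeCount≤ : (a : Fin n → Fin n → Bool) → edgeCount a ≤ n * n
edgeCount≤ {zero}  a = z≤n
edgeCount≤ {suc n} a =
  ≤-trans (+-mono-≤ (count≤ (λ v → a zero (suc v))) (edgeCount≤ (λ u v → a (suc u) (suc v))))
    (+-mono-≤ (n≤1+n n) (*-monoʳ-≤ n (n≤1+n n)))

param-positive : ∀ {v} → 1 ≤ v → param v ≡ + v
param-positive (s≤s _) = refl

⁺-≤ : ∀ k {s} → k ℤ.≤ + s → k ⁺ ≤ s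
⁺-≤ (+ k)    (+≤+ k≤s) = k≤s
⁺-≤ -[1+ k ] _         = z≤n

≤-⁺ : ∀ k {s} → k ⁺ ≤ s → k ℤ.≤ + s
≤-⁺ (+ k)    k≤s = +≤+ k≤s
≤-⁺ -[1+ k ] _   = -≤+

-- From a clique to a cluster deletion

kept : ∀ m → (Fin n → Bool) → Fin (m + n) → Bool
kept zero    p v       = p v
kept (suc m) p zero    = true
kept (suc m) p (suc v) = kept m p v

count-not-kept : ∀ m (p : Fin n → Bool) → count (not ∘ kept m p) ≡ count (not ∘ p)
count-not-kept zero    p = refl
count-not-kept (suc m) p = count-not-kept m p

module _ (G : SimpleGraph n) where

  -- All edges go except those inside the cluster of `p` and the universal vertices, so every other
  -- vertex becomes isolated.
  deletion : ∀ m → (Fin n → Bool) → SimpleGraph (m + n)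
  deletion m p = record
    { adj    = λ u v → adj G′ u v ∧ not (kept m p u ∧ kept m p v)
    ; sym    = λ u v → cong₂ (λ x y → x ∧ not y) (SimpleGraph.sym G′ u v)
                         (∧-comm (kept m p u) (kept m p v))
    ; irrefl = λ u → cong (_∧ not (kept m p u ∧ kept m p u)) (irrefl G′ u)
    }
    where
    G′ = addUniversals m G

  -- A universal vertex keeps its edges to the other universal vertices and loses one edge per old
  -- vertex outside `p`; n * n covers the deleted edges of G.
  deletion-size : ∀ m p → edgeCount (adj (deletion m p)) ≤ m * count (not ∘ p) + n * n
  deletion-size zero    p = edgeCount≤ (adj (deletion 0 p))
  deletion-size (suc m) p = ≤-trans
    (+-mono-≤ (≤-reflexive (count-not-kept m p)) (deletion-size m p))
    (≤-reflexive (sym (+-assoc (count (not ∘ p)) _ _)))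

  kept-clique : ∀ m p → IsClique G (T ∘ p) → IsClique (addUniversals m G) (T ∘ kept m p)
  kept-clique zero    p cl = cl
  kept-clique (suc m) p cl zero    zero    _  _  0≢0 = 0≢0 refl
  kept-clique (suc m) p cl zero    (suc v) _  _  _   = tt
  kept-clique (suc m) p cl (suc u) zero    _  _  _   = tt
  kept-clique (suc m) p cl (suc u) (suc v) pu pv u≢v =
    kept-clique m p cl u v pu pv (u≢v ∘ cong suc)

  remaining : ∀ a x y → T (a ∧ not (a ∧ not (x ∧ y))) → T x × T y
  remaining true true true _ = tt , tt

  remaining⁻¹ : ∀ a x y → T a → T x → T y → T (a ∧ not (a ∧ not (x ∧ y)))
  remaining⁻¹ true true true _ _ _ = tt

  -- Both ends of a surviving edge are kept, hence so are both ends of any path of positive length,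
  -- and the kept vertices form a clique.
  deletion-cluster : ∀ m p → IsClique G (T ∘ p) →
                     IsClusterGraph (addUniversals m G ∖ deletion m p)
  deletion-cluster m p cl w u v w⇝u w⇝v u≢v = join (ends w⇝u) (ends w⇝v)
    where
    G′ = addUniversals m G
    K  = T ∘ kept m p
    ends : ∀ {w v} → Component (G′ ∖ deletion m p) w v → w ≡ v ⊎ (K w × K v)
    ends ε = inj₁ refl
    ends {w} (_◅_ {j = x} e es) with remaining (adj G′ w x) _ _ e | ends es
    ... | kw , kx | inj₁ refl     = inj₂ (kw , kx)
    ... | kw , kx | inj₂ (_ , kv) = inj₂ (kw , kv)
    edge : K u → K v → Adj (G′ ∖ deletion m p) u v
    edge ku kv = remaining⁻¹ (adj G′ u v) _ _ (kept-clique m p cl u v ku kv u≢v) ku kv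
    join : w ≡ u ⊎ (K w × K u) → w ≡ v ⊎ (K w × K v) → Adj (G′ ∖ deletion m p) u v
    join (inj₁ refl)      (inj₁ refl)      = ⊥-elim (u≢v refl)
    join (inj₁ refl)      (inj₂ (ku , kv)) = edge ku kv
    join (inj₂ (kv , ku)) (inj₁ refl)      = edge ku kv
    join (inj₂ (_ , ku))  (inj₂ (_ , kv))  = edge ku kv

  clique⇒deletion : ∀ k → HasClique (n , G) k →
    HasClusterDeletion (suc (scale n) + n , addUniversals (suc (scale n)) G) (targetParam n k)
  clique⇒deletion k (S , cl , k≤S) =
    deletion (suc q) p ,
    (λ u v → proj₁ ∘ Equivalence.to T-∧) ,
    deletion-cluster (suc q) p (λ u v pu pv → cl u v (∈S u pu) (∈S v pv)) ,
    subst (λ z → + #edges (deletion (suc q) p) ℤ.≤ z) (sym (param-positive 1≤cq)) (+≤+ size)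
    where
    p = lookup S
    q = scale n
    c = suc n ∸ k ⁺
    d = count (not ∘ p)
    ∈S : ∀ u → T (p u) → u ∈ S
    ∈S u pu = lookup⇒[]= u S (Equivalence.to T-≡ pu)
    k≤ : k ⁺ ≤ ∣ S ∣
    k≤ = ⁺-≤ k k≤S
    d<c : d < c
    d<c = m+n≤o⇒m≤o∸n (suc d) (s≤s (begin
      d + k ⁺      ≤⟨ +-monoʳ-≤ d k≤ ⟩
      d + ∣ S ∣    ≡⟨ cong (_+_ d) (∣S∣≡count S) ⟩
      d + count p  ≡⟨ +-comm d (count p) ⟩
      count p + d  ≡⟨ count-not p ⟩
      n            ∎))
      where open ≤-Reasoning
    -- The bound is positive, so `param` leaves it unchanged.
    1≤cq : 1 ≤ c * q
    1≤cq = *-mono-≤ {1} {c} {1} {q} (≤-trans (s≤s z≤n) d<c) (s≤s z≤n)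
    size : #edges (deletion (suc q) p) ≤ c * q
    size = begin
      #edges (deletion (suc q) p)            ≡⟨ #edges≡edgeCount (deletion (suc q) p) ⟩
      edgeCount (adj (deletion (suc q) p))   ≤⟨ deletion-size (suc q) p ⟩
      d + q * d + n * n                      ≡⟨ cong (_+ n * n) (+-comm d (q * d)) ⟩
      q * d + d + n * n                      ≡⟨ +-assoc (q * d) d (n * n) ⟩
      -- The terms beyond q d come to at most n + n * n = q - 1; q was chosen to absorb them.
      q * d + (d + n * n)                    ≤⟨ +-monoʳ-≤ (q * d) (+-monoˡ-≤ (n * n) (count≤ (not ∘ p))) ⟩
      q * d + (n + n * n)                    ≡⟨ cong (λ x → q * d + x) (*-suc n n) ⟨
      q * d + n * suc n                      ≤⟨ +-monoʳ-≤ (q * d) (n≤1+n _) ⟩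
      q * d + q                              ≡⟨ +-comm (q * d) q ⟩
      q + q * d                              ≡⟨ *-suc q d ⟨
      q * suc d                              ≤⟨ *-monoʳ-≤ q d<c ⟩
      q * c                                  ≡⟨ *-comm q c ⟩
      c * q                                  ∎
      where open ≤-Reasoning

  -- From a cluster deletion to a clique

  adj-old : ∀ m u v → adj (addUniversals m G) (m ↑ʳ u) (m ↑ʳ v) ≡ adj G u v
  adj-old zero    u v = refl
  adj-old (suc m) u v = adj-old m u v

  -- Pigeonhole: if each of the m universal vertices has at least c marked pairs with old vertices,
  -- these add up. None is counted twice, as universal vertices precede the old ones.
  cheap-universal : ∀ m c (a : Fin (m + n) → Fin (m + n) → Bool) →
    (∃[ u ] (∀ v → adj (addUniversals m G) u (m ↑ʳ v) ≡ true) × count (λ v → a u (m ↑ʳ v)) < c) ⊎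
    m * c ≤ edgeCount a
  cheap-universal zero    c a = inj₂ z≤n
  cheap-universal (suc m) c a with count (λ v → a zero (suc (m ↑ʳ v))) <? c
  ... | yes few = inj₁ (zero , (λ v → refl) , few)
  ... | no many with cheap-universal m c (λ u v → a (suc u) (suc v))
  ...   | inj₁ (u , universal , few) = inj₁ (suc u , universal , few)
  ...   | inj₂ mc≤ =
    inj₂ (+-mono-≤ (≤-trans (≮⇒≥ many) (count-↑ʳ m (λ v → a zero (suc v)))) mc≤)

  deletion⇒clique : ∀ k →
    HasClusterDeletion (suc (scale n) + n , addUniversals (suc (scale n)) G) (targetParam n k) →
    HasClique (n , G) k
  deletion⇒clique k (D , _ , cluster , D≤) = result (cheap-universal (suc q) c (adj D))
    where
    q  = scale n
    c  = suc n ∸ k ⁺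
    G′ = addUniversals (suc q) G
    old : Fin n → Fin (suc q + n)
    old = suc q ↑ʳ_

    -- Generalised over c so that `param` computes. For c = 0 the bound is -1, which no deletion
    -- meets; for positive c the inequality c q < (q + 1) c is strict.
    few-deleted : ∀ c → + #edges D ℤ.≤ param (c * q) → edgeCount (adj D) < suc q * c
    few-deleted (suc c) (+≤+ D≤) = begin-strict
      edgeCount (adj D)  ≡⟨ #edges≡edgeCount D ⟨
      #edges D           ≤⟨ D≤ ⟩
      suc c * q          <⟨ m<n+m (suc c * q) (s≤s z≤n) ⟩
      suc c + suc c * q  ≡⟨ *-suc (suc c) q ⟨
      suc c * suc q      ≡⟨ *-comm (suc c) (suc q) ⟩
      suc q * suc c      ∎
      where open ≤-Reasoning

    result : (∃[ u ] (∀ v → adj G′ u (old v) ≡ true) × count (λ v → adj D u (old v)) < c) ⊎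
             suc q * c ≤ edgeCount (adj D) → HasClique (n , G) k
    result (inj₂ many) = ⊥-elim (<⇒≱ (few-deleted c D≤) many)
    result (inj₁ (u , universal , few)) = Vec.tabulate p , clique , ≤-⁺ k large
      where
      p : Fin n → Bool
      p v = not (adj D u (old v))

      -- The edge from `u` to each old vertex selected by `p` survives, so these vertices lie in one
      -- component and the cluster property makes them pairwise adjacent.
      reach : ∀ v → v ∈ Vec.tabulate p → Component (G′ ∖ D) u (old v)
      reach v v∈ = subst T (sym (cong₂ _∧_ (universal v)
        (trans (sym (lookup∘tabulate p v)) ([]=⇒lookup v∈)))) tt ◅ ε

      clique : IsClique G (_∈ Vec.tabulate p)
      clique v w v∈ w∈ v≢w = subst T (adj-old (suc q) v w)
        (proj₁ (Equivalence.to T-∧ (cluster u (old v) (old w) (reach v v∈) (reach w w∈)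
          (v≢w ∘ ↑ʳ-injective (suc q) v w))))

      large : k ⁺ ≤ ∣ Vec.tabulate p ∣
      large = +-cancelˡ-≤ x _ _ (begin
        x + k ⁺                  ≤⟨ ≤-pred (m≤o∸n⇒m+n≤o (suc x) k≤ few) ⟩
        n                        ≡⟨ count-not (λ v → adj D u (old v)) ⟨
        x + count p              ≡⟨ cong (_+_ x) (∣tabulate∣≡count p) ⟨
        x + ∣ Vec.tabulate p ∣   ∎)
        where
        open ≤-Reasoning
        x = count (λ v → adj D u (old v))
        -- Since some number is below c, c is not 0, so the subtraction n + 1 - k was not truncated.
        k≤ : k ⁺ ≤ suc n
        k≤ = <⇒≤ (m∸n≢0⇒n<m λ c≡0 → <⇒≱ few (≤-trans (≤-reflexive c≡0) z≤n))

  clique⇔deletion : ∀ k → HasClique (n , G) k ⇔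
    HasClusterDeletion (suc (scale n) + n , addUniversals (suc (scale n)) G) (targetParam n k)
  clique⇔deletion k = mk⇔ (clique⇒deletion k) (deletion⇒clique k)

-- The reduction on a graph class

addUniversals-closed : ∀ {ℓ} {𝒢 : GraphClass ℓ} → ClosedUnderUniversal 𝒢 →
  ∀ m {n} {G : SimpleGraph n} → 𝒢 (n , G) → 𝒢 (m + n , addUniversals m G)
addUniversals-closed closed zero    G∈ = G∈
addUniversals-closed closed (suc m) G∈ = closed _ (addUniversals-closed closed m G∈)

theorem1p3 : ∀ {ℓ} (𝒢 : GraphClass ℓ) →
    NPHard (CliqueOn 𝒢) →
    ClosedUnderUniversal 𝒢 →
    NPHard (ClusterDeletionOn 𝒢)
theorem1p3 𝒢 hard closed L L∈NP with hard L L∈NP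
... | f , f-poly , red = g , g-poly , λ x → reduce (proj₁ (red x)) , refl , equivalence x
  where
  open Problem

  reduce : Instance (CliqueOn 𝒢) → Instance (ClusterDeletionOn 𝒢)
  reduce (((n , G) , G∈) , k) =
    ((suc (scale n) + n , addUniversals (suc (scale n)) G) ,
     addUniversals-closed closed (suc (scale n)) G∈) , targetParam n k

  -- `g` is defined through the instance that f x encodes, not by parsing words. The machine for `f`
  -- followed by `transform` on nine fresh stacks computes it.
  g : List Bool → List Bool
  g x = encode (ClusterDeletionOn 𝒢) (reduce (proj₁ (red x)))

  g-poly : PolyTime g
  g-poly = polyTime-then 9 f-poly (λ e → transform) boundₚ λ x {e} ρ →
    let ((_ , G) , _) , k = proj₁ (red x) in
    subst (λ w → ∃[ τ ] (Run (eval boundₚ (length w)) (transform {e}) (embed 9 (w ∷ ρ)) τ ×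
                         Vec.head τ ≡ g x))
      (proj₁ (proj₂ (red x))) (transform-bounded ρ G k)

  equivalence : ∀ x → L x ⇔ Yes (ClusterDeletionOn 𝒢) (reduce (proj₁ (red x)))
  equivalence x = let ((_ , G) , _) , k = proj₁ (red x) in
    clique⇔deletion G k ⇔-∘ proj₂ (proj₂ (red x))
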